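{- Let $q$ be a prime power, let $m,n\ge 1$, and let $\mathcal{C}$ be an $[n,k,d]_{q^m/q}$ code. Then $\mathcal{C}$ is $2$-rank-frameproof if and only if it is rank-metric intersecting.
   Context: Support and rank: fix an $\mathbb{F}_q$-basis $\Gamma$ of $\mathbb{F}_{q^m}$. For $x=(x_1,\dots,x_n)\in\mathbb{F}_{q^m}^n$ let $\mathrm{Mat}_\Gamma(x)\in\mathbb{F}_q^{m\times n}$ be the matrix whose $j$-th column is the coordinate vector of $x_j$ in the basis $\Gamma$. The support $\sigma(x)\subseteq\mathbb{F}_q^n$ is the $\mathbb{F}_q$-row space of $\mathrm{Mat}_\Gamma(x)$, and $\mathrm{rk}(x)=\dim_{\mathbb{F}_q}\sigma(x)$; both are independent of $\Gamma$. An $[n,k,d]_{q^m/q}$ code is an $\mathbb{F}_{q^m}$-linear subspace $\mathcal{C}$ of $\mathbb{F}_{q^m}^n$ with $k=\dim_{\mathbb{F}_{q^m}}\mathcal{C}\ge 1$ and minimum distance $d=\min_{c\in\mathcal{C}\setminus\{0\}}\mathrm{rk}(c)$. The code is rank-metric intersecting if $\sigma(c)\cap\sigma(c')\ne\{0\}$ for all $c,c'\in\mathcal{C}\setminus\{0\}$. For a subset $\mathcal{C}\subseteq\mathbb{F}_{q^m}^n$ and $\mathcal{S}\subseteq\mathcal{C}$, the set of rank-metric descendants of $\mathcal{S}$ is $\mathrm{desc}_{\mathrm{rk}}(\mathcal{S})=\{w\in\mathbb{F}_{q^m}^n : \bigcap_{c\in\mathcal{S}}\sigma(w-c)=\{0\}\}$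 (an empty intersection being $\mathbb{F}_q^n$). For $s\ge 2$, $\mathcal{C}$ is $s$-rank-frameproof if $\mathrm{desc}_{\mathrm{rk}}(\mathcal{S})\cap(\mathcal{C}\setminus\mathcal{S})=\varnothing$ for every $\mathcal{S}\subseteq\mathcal{C}$ with $|\mathcal{S}|\le s$. -}

module Defs where

open import Level using (Level; _⊔_; suc)
open import Algebra.Bundles using (CommutativeRing; Ring)
open import Algebra.Module.Bundles using (LeftModule)
import Algebra.Definitions.RawMonoid as RawMonoidDefs
open import Algebra.Morphism.Structures using (module RingMorphisms)
open import Data.Fin.Base using (Fin)
open import Data.Nat.Base using (ℕ; _≤_; _^_)
open import Data.Nat.Primality using (Prime)
open import Data.Product.Base using (∃; ∃₂; ∃-syntax; Σ-syntax; _×_; _,_; proj₁; proj₂)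
open import Data.Unit.Base using (tt)
open import Data.Vec.Functional using (Vector)
open import Function.Bundles using (Inverse)
open import Relation.Binary.Bundles using (Setoid)
import Relation.Binary.Construct.On as On
open import Relation.Binary.Definitions using (_Respects_)
import Relation.Binary.PropositionalEquality as ≡
open import Relation.Nullary.Negation using (¬_)
open import Relation.Unary using (Pred; U; _∈_; _⊆_; _≐_; _∩_; _∖_; ⋂; Empty)

private
  variable
    a c c₁ c₂ ℓ ℓ₁ ℓ₂ p r ℓr : Level

IsPrimePower : ℕ → Set
IsPrimePower q = ∃₂ λ p e → Prime p × 1 ≤ e × q ≡.≡ p ^ e

HasCardinality : Setoid a ℓ → ℕ → Set (a ⊔ ℓ)
HasCardinality A t = Inverse A (≡.setoid (Fin t))

record FiniteField (q : ℕ) (c ℓ : Level) : Set (suc (c ⊔ ℓ)) where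
  field
    commutativeRing : CommutativeRing c ℓ
  open CommutativeRing commutativeRing public
  field
    0≉1         : ¬ (0# ≈ 1#)
    inverse     : ∀ x → ¬ (x ≈ 0#) → ∃[ y ] x * y ≈ 1#
    cardinality : HasCardinality setoid q

vectorModule : (R : Ring c ℓ) (n : ℕ) → LeftModule R c ℓ
vectorModule R n = record
  { Carrierᴹ = Vector Carrier n
  ; _≈ᴹ_ = λ x y → ∀ i → x i ≈ y i
  ; _+ᴹ_ = λ x y i → x i + y i
  ; _*ₗ_ = λ s x i → s * x i
  ; 0ᴹ = λ _ → 0#
  ; -ᴹ_ = λ x i → - x i
  ; isLeftModule = record
    { isLeftSemimodule = record
      { +ᴹ-isCommutativeMonoid = record
        { isMonoid = record
          { isSemigroup = record
            { isMagma = record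
              { isEquivalence = record
                { refl = λ _ → refl
                ; sym = λ p i → sym (p i)
                ; trans = λ p q i → trans (p i) (q i)
                }
              ; ∙-cong = λ p q i → +-cong (p i) (q i)
              }
            ; assoc = λ x y z i → +-assoc (x i) (y i) (z i)
            }
          ; identity = (λ x i → +-identityˡ (x i)) , (λ x i → +-identityʳ (x i))
          }
        ; comm = λ x y i → +-comm (x i) (y i)
        }
      ; isPreleftSemimodule = record
        { *ₗ-cong = λ s p i → *-cong s (p i)
        ; *ₗ-zeroˡ = λ x i → zeroˡ (x i)
        ; *ₗ-distribʳ = λ x s t i → distribʳ (x i) s t
        ; *ₗ-identityˡ = λ x i → *-identityˡ (x i)
        ; *ₗ-assoc = λ s t x i → *-assoc s t (x i)
        ; *ₗ-zeroʳ = λ s i → zeroʳ s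
        ; *ₗ-distribˡ = λ s x y i → distribˡ s (x i) (y i)
        }
      }
    ; -ᴹ‿cong = λ p i → -‿cong (p i)
    ; -ᴹ‿inverse = (λ x i → -‿inverseˡ (x i)) , (λ x i → -‿inverseʳ (x i))
    }
  }
  where open Ring R

-- An inclusion of fields is a ring homomorphism; injectivity is automatic.
record Extension {q Q : ℕ} (F : FiniteField q c₁ ℓ₁) (K : FiniteField Q c₂ ℓ₂)
                 : Set (c₁ ⊔ ℓ₁ ⊔ c₂ ⊔ ℓ₂) where
  private
    module F = FiniteField F
    module K = FiniteField K
  open RingMorphisms F.rawRing K.rawRing using (IsRingHomomorphism)
  field
    ι                  : F.Carrier → K.Carrier
    isRingHomomorphism : IsRingHomomorphism ι
  open IsRingHomomorphism isRingHomomorphism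

  leftModule : LeftModule F.ring c₂ ℓ₂
  leftModule = record
    { Carrierᴹ = K.Carrier
    ; _≈ᴹ_ = K._≈_
    ; _+ᴹ_ = K._+_
    ; _*ₗ_ = λ s x → ι s K.* x
    ; 0ᴹ = K.0#
    ; -ᴹ_ = K.-_
    ; isLeftModule = record
      { isLeftSemimodule = record
        { +ᴹ-isCommutativeMonoid = K.+-isCommutativeMonoid
        ; isPreleftSemimodule = record
          { *ₗ-cong = λ s p → K.*-cong (⟦⟧-cong s) p
          ; *ₗ-zeroˡ = λ x → K.trans (K.*-congʳ 0#-homo) (K.zeroˡ x)
          ; *ₗ-distribʳ = λ x s t →
              K.trans (K.*-congʳ (+-homo s t)) (K.distribʳ x (ι s) (ι t))
          ; *ₗ-identityˡ = λ x → K.trans (K.*-congʳ 1#-homo) (K.*-identityˡ x)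
          ; *ₗ-assoc = λ s t x →
              K.trans (K.*-congʳ (*-homo s t)) (K.*-assoc (ι s) (ι t) x)
          ; *ₗ-zeroʳ = λ s → K.zeroʳ (ι s)
          ; *ₗ-distribˡ = λ s x y → K.distribˡ (ι s) x y
          }
        }
      ; -ᴹ‿cong = K.-‿cong
      ; -ᴹ‿inverse = K.-‿inverse
      }
    }

module Linear {R : Ring r ℓr} (M : LeftModule R a ℓ) where
  private
    module R = Ring R
  open LeftModule M
  open RawMonoidDefs +ᴹ-rawMonoid using (sum)

  linearCombination : ∀ {k} → Vector R.Carrier k → Vector Carrierᴹ k → Carrierᴹ
  linearCombination s v = sum (λ i → s i *ₗ v i)

  span : ∀ {k} → Vector Carrierᴹ k → Pred Carrierᴹ (r ⊔ ℓ)
  span v x = ∃[ s ] linearCombination s v ≈ᴹ x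

  LinearlyIndependent : ∀ {k} → Vector Carrierᴹ k → Set (r ⊔ ℓr ⊔ ℓ)
  LinearlyIndependent v =
    ∀ s → linearCombination s v ≈ᴹ 0ᴹ → ∀ i → s i R.≈ R.0#

  ｛0｝ : Pred Carrierᴹ ℓ
  ｛0｝ x = x ≈ᴹ 0ᴹ

  record IsSubspace (P : Pred Carrierᴹ p) : Set (r ⊔ a ⊔ ℓ ⊔ p) where
    field
      respects  : P Respects _≈ᴹ_
      0ᴹ-closed : 0ᴹ ∈ P
      +ᴹ-closed : ∀ {x y} → x ∈ P → y ∈ P → x +ᴹ y ∈ P
      *ₗ-closed : ∀ s {x} → x ∈ P → s *ₗ x ∈ P

  record IsBasis (P : Pred Carrierᴹ p) {k : ℕ} (v : Vector Carrierᴹ k)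
                 : Set (r ⊔ ℓr ⊔ a ⊔ ℓ ⊔ p) where
    field
      members     : ∀ i → v i ∈ P
      independent : LinearlyIndependent v
      spanning    : P ⊆ span v

  HasDimension : Pred Carrierᴹ p → ℕ → Set (r ⊔ ℓr ⊔ a ⊔ ℓ ⊔ p)
  HasDimension P k = Σ[ v ∈ Vector Carrierᴹ k ] IsBasis P v

record ExtensionBasis {q Q : ℕ} {F : FiniteField q c₁ ℓ₁}
                      {K : FiniteField Q c₂ ℓ₂} (K/F : Extension F K) (m : ℕ)
                      : Set (c₁ ⊔ ℓ₁ ⊔ c₂ ⊔ ℓ₂) where
  open Linear (Extension.leftModule K/F) using (IsBasis)
  field
    Γ       : Vector (FiniteField.Carrier K) m
    isBasis : IsBasis U Γ
  open IsBasis isBasis public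

  coordinates : FiniteField.Carrier K → Vector (FiniteField.Carrier F) m
  coordinates x = proj₁ (spanning {x} tt)

module RankMetric {q Q m : ℕ} {F : FiniteField q c₁ ℓ₁} {K : FiniteField Q c₂ ℓ₂}
                  {K/F : Extension F K} (B : ExtensionBasis K/F m) (n : ℕ) where
  private
    module F = FiniteField F
    module K = FiniteField K
    module Fⁿ where
      open LeftModule (vectorModule F.ring n) public
      open Linear (vectorModule F.ring n) public
    module Kⁿ where
      open LeftModule (vectorModule K.ring n) public
      open Linear (vectorModule K.ring n) public
  open ExtensionBasis B using (coordinates)

  Word : Set c₂
  Word = Vector K.Carrier n

  Mat : Word → Fin m → Fin n → F.Carrier
  Mat x i j = coordinates (x j) i

  -- The row space: Mat x is read as the family of its m rows.
  σ : Word → Pred (Vector F.Carrier n) (c₁ ⊔ ℓ₁)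
  σ x = Fⁿ.span (Mat x)

  HasRank : Word → ℕ → Set (c₁ ⊔ ℓ₁)
  HasRank x = Fⁿ.HasDimension (σ x)

  NonzeroIn : Pred Word p → Pred Word (ℓ₂ ⊔ p)
  NonzeroIn C = C ∖ Kⁿ.｛0｝

  record HasMinimumDistance (C : Pred Word p) (d : ℕ)
                            : Set (c₁ ⊔ ℓ₁ ⊔ c₂ ⊔ ℓ₂ ⊔ p) where
    field
      attained : ∃[ x ] x ∈ NonzeroIn C × HasRank x d
      minimal  : ∀ x → x ∈ NonzeroIn C → ∀ t → HasRank x t → d ≤ t

  record IsCode (k d : ℕ) (C : Pred Word p) : Set (c₁ ⊔ ℓ₁ ⊔ c₂ ⊔ ℓ₂ ⊔ p) where
    field
      isSubspace      : Kⁿ.IsSubspace C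
      dimension       : Kⁿ.HasDimension C k
      1≤k             : 1 ≤ k
      minimumDistance : HasMinimumDistance C d

  IsIntersecting : Pred Word p → Set (c₁ ⊔ ℓ₁ ⊔ c₂ ⊔ ℓ₂ ⊔ p)
  IsIntersecting C =
    ∀ x y → x ∈ NonzeroIn C → y ∈ NonzeroIn C → ¬ (σ x ∩ σ y ≐ Fⁿ.｛0｝)

  desc : Pred Word p → Pred Word (c₁ ⊔ ℓ₁ ⊔ c₂ ⊔ p)
  desc S w = ⋂ (∃ S) (λ (x , _) → σ (w Kⁿ.+ᴹ (Kⁿ.-ᴹ x))) ≐ Fⁿ.｛0｝

  -- Distinct elements are counted up to ≈ᴹ.
  CardinalityAtMost : Pred Word p → ℕ → Set (c₂ ⊔ ℓ₂ ⊔ p)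
  CardinalityAtMost S s =
    ∃[ t ] t ≤ s × HasCardinality (On.setoid Kⁿ.≈ᴹ-setoid (proj₁ {B = S})) t

  -- A subset of Kⁿ is a predicate respecting ≈ᴹ.  Fixing S at level ℓ₂ loses
  -- nothing: a finite S is equivalent to "x ≈ᴹ one of its listed elements".
  IsFrameproof : ℕ → Pred Word p → Set (c₁ ⊔ ℓ₁ ⊔ c₂ ⊔ suc ℓ₂ ⊔ p)
  IsFrameproof s C =
    ∀ (S : Pred Word ℓ₂) → S Respects Kⁿ._≈ᴹ_ → S ⊆ C →
    CardinalityAtMost S s → Empty (desc S ∩ (C ∖ S))

{-# OPTIONS --safe #-}
-- Translating by w turns the condition on a pair S = {a, b} ⊆ C and a word w
-- into σ(w − a) ∩ σ(w − b) = {0} for the nonzero codewords w − a and w − b;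
-- conversely nonzero codewords x, y with σ(x) ∩ σ(y) = {0} make 0 a descendant
-- of {−x, −y}.  The empty S has no descendants because n ≥ 1.
module Submission where

open import Defs
open import Level using (Level; _⊔_)
open import Algebra.Bundles using (Ring)
open import Algebra.Module.Bundles using (LeftModule)
import Algebra.Properties.AbelianGroup as AbelianGroupProperties
import Algebra.Properties.CommutativeMonoid.Sum as SumProperties
open import Data.Fin.Base using (Fin; zero; suc)
import Data.Fin.Properties as Fin
open import Data.Nat.Base using (ℕ; _≤_; _^_; z≤n; s≤s)
open import Data.Product.Base using (∃; ∃₂; ∃-syntax; _×_; _,_; proj₁; proj₂)
open import Data.Sum.Base using (_⊎_; inj₁; inj₂; [_,_]′)
open import Data.Vec.Functional using (Vector)
open import Data.Vec.Functional.Relation.Binary.Pointwise.Properties using (decidable)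
open import Function.Bundles using (_⇔_; mk⇔; Inverse)
open import Function.Properties.Inverse using (Inverse⇒Injection)
open import Relation.Binary.Bundles using (Setoid)
import Relation.Binary.Construct.On as On
open import Relation.Binary.Definitions using (Decidable; _Respects_)
import Relation.Binary.PropositionalEquality as ≡
open import Relation.Nullary.Decidable using (Dec; yes; no; via-injection)
open import Relation.Nullary.Negation using (¬_; contradiction)
open import Relation.Unary using (Pred; _∈_; _∉_; _⊆_; _≐_; _∩_)

private
  variable
    a c₁ c₂ ℓ ℓ₁ ℓ₂ p r ℓr : Level

-- Setoids with at most two elements.

module _ (A : Setoid a ℓ) where
  open Setoid A

  -- The two elements may coincide, so singletons and genuine pairs are treated alike.
  Covers : Carrier → Carrier → Set (a ⊔ ℓ)
  Covers x y = ∀ z → z ≈ x ⊎ z ≈ y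

  finite⇒decidable : ∀ {t} → HasCardinality A t → Decidable _≈_
  finite⇒decidable A↔Fin = via-injection (Inverse⇒Injection A↔Fin) Fin._≟_

  -- The exact count is 1 or 2 according to whether `x ≈ y`, which is why a decision of that
  -- equation is taken as input.
  covered⇒cardinality≤2 : ∀ {x y} → Dec (x ≈ y) → Covers x y →
                          ∃[ t ] t ≤ 2 × HasCardinality A t
  covered⇒cardinality≤2 {x} {y} (yes x≈y) covers = 1 , s≤s z≤n , record
    { to        = λ _ → zero
    ; from      = λ _ → x
    ; to-cong   = λ _ → ≡.refl
    ; from-cong = λ _ → refl
    ; inverse   = (λ { {zero} _ → ≡.refl })
                , (λ {z} _ → sym (reduce-to-x (covers z)))
    }
    where
    reduce-to-x : ∀ {z} → z ≈ x ⊎ z ≈ y → z ≈ x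
    reduce-to-x (inj₁ z≈x) = z≈x
    reduce-to-x (inj₂ z≈y) = trans z≈y (sym x≈y)
  covered⇒cardinality≤2 {x} {y} (no x≉y) covers = 2 , s≤s (s≤s z≤n) , record
    { to        = λ z → index (covers z)
    ; from      = element
    ; to-cong   = λ {z} {z′} z≈z′ → index-cong (covers z) (covers z′) z≈z′
    ; from-cong = λ { ≡.refl → refl }
    ; inverse   = (λ {i} {z} z≈eᵢ → index-element i (covers z) z≈eᵢ)
                , (λ { {z} ≡.refl → element-index (covers z) })
    }
    where
    element : Fin 2 → Carrier
    element zero       = x
    element (suc zero) = y

    index : ∀ {z} → z ≈ x ⊎ z ≈ y → Fin 2
    index (inj₁ _) = zero
    index (inj₂ _) = suc zero

    element-index : ∀ {z} (e : z ≈ x ⊎ z ≈ y) → element (index e) ≈ z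
    element-index (inj₁ z≈x) = sym z≈x
    element-index (inj₂ z≈y) = sym z≈y

    -- Here `x≉y` enters: nothing equals both `x` and `y`, so the side chosen by a cover depends
    -- only on the element. This makes `index` well defined up to `≈`.
    index-element : ∀ i {z} (e : z ≈ x ⊎ z ≈ y) → z ≈ element i → index e ≡.≡ i
    index-element zero       (inj₁ _)   _   = ≡.refl
    index-element zero       (inj₂ z≈y) z≈x = contradiction (trans (sym z≈x) z≈y) x≉y
    index-element (suc zero) (inj₁ z≈x) z≈y = contradiction (trans (sym z≈x) z≈y) x≉y
    index-element (suc zero) (inj₂ _)   _   = ≡.refl

    index-cong : ∀ {z z′} (e : z ≈ x ⊎ z ≈ y) (e′ : z′ ≈ x ⊎ z′ ≈ y) →
                 z ≈ z′ → index e ≡.≡ index e′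
    index-cong e e′ z≈z′ =
      index-element (index e′) e (trans z≈z′ (sym (element-index e′)))

  -- Enumerating by `from` leaves three sizes. Size 0 stays apart, having no element to list; size 1
  -- lists its element twice.
  cardinality≤2⇒empty⊎covered : ∀ {t} → t ≤ 2 → HasCardinality A t →
                                ¬ Carrier ⊎ ∃₂ Covers
  cardinality≤2⇒empty⊎covered z≤n A↔Fin =
    inj₁ λ z → Fin.¬Fin0 (Inverse.to A↔Fin z)
  cardinality≤2⇒empty⊎covered (s≤s z≤n) A↔Fin =
    inj₂ (from zero , from zero , λ z → cover (to z) (sym (strictlyInverseʳ z)))
    where
    open Inverse A↔Fin
    cover : ∀ {z} i → z ≈ from i → z ≈ from zero ⊎ z ≈ from zero
    cover zero = inj₁
  cardinality≤2⇒empty⊎covered (s≤s (s≤s z≤n)) A↔Fin =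
    inj₂ (from zero , from (suc zero) , λ z → cover (to z) (sym (strictlyInverseʳ z)))
    where
    open Inverse A↔Fin
    cover : ∀ {z} i → z ≈ from i → z ≈ from zero ⊎ z ≈ from (suc zero)
    cover zero       = inj₁
    cover (suc zero) = inj₂

-- Linear combinations, spans and subspaces.

module _ {R : Ring r ℓr} (M : LeftModule R a ℓ) where
  private module R = Ring R
  open LeftModule M
  open Linear M
  open SumProperties +ᴹ-commutativeMonoid using (sum-cong-≋; sum-replicate-zero; ∑-distrib-+)

  linearCombination-cong : ∀ {k} {s t : Vector R.Carrier k} {u v : Vector Carrierᴹ k} →
                           (∀ i → s i R.≈ t i) → (∀ i → u i ≈ᴹ v i) →
                           linearCombination s u ≈ᴹ linearCombination t v
  linearCombination-cong s≈t u≈v = sum-cong-≋ λ i → *ₗ-cong (s≈t i) (u≈v i)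

  linearCombination-zero : ∀ {k} (v : Vector Carrierᴹ k) →
                           linearCombination (λ _ → R.0#) v ≈ᴹ 0ᴹ
  linearCombination-zero {k} v =
    ≈ᴹ-trans (sum-cong-≋ λ i → *ₗ-zeroˡ (v i)) (sum-replicate-zero k)

  linearCombination-+ : ∀ {k} (s t : Vector R.Carrier k) (v : Vector Carrierᴹ k) →
                        linearCombination (λ i → s i R.+ t i) v
                          ≈ᴹ linearCombination s v +ᴹ linearCombination t v
  linearCombination-+ s t v =
    ≈ᴹ-trans (sum-cong-≋ λ i → *ₗ-distribʳ (v i) (s i) (t i))
             (∑-distrib-+ (λ i → s i *ₗ v i) (λ i → t i *ₗ v i))

  independent⇒coefficients-unique :
    ∀ {k} {v : Vector Carrierᴹ k} → LinearlyIndependent v →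
    ∀ s t → linearCombination s v ≈ᴹ linearCombination t v → ∀ i → s i R.≈ t i
  independent⇒coefficients-unique {v = v} independent s t eq i =
    x∙y⁻¹≈ε⇒x≈y (s i) (t i) (independent (λ j → s j R.- t j) difference≈0 i)
    where
    open AbelianGroupProperties R.+-abelianGroup using (x∙y⁻¹≈ε⇒x≈y)
    -t : Vector R.Carrier _
    -t j = R.- t j
    difference≈0 : linearCombination (λ j → s j R.- t j) v ≈ᴹ 0ᴹ
    difference≈0 =
      ≈ᴹ-trans (linearCombination-+ s -t v)
      (≈ᴹ-trans (+ᴹ-congʳ eq)
      (≈ᴹ-trans (≈ᴹ-sym (linearCombination-+ t -t v))
      (≈ᴹ-trans (linearCombination-cong (λ j → R.-‿inverseʳ (t j)) (λ _ → ≈ᴹ-refl))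
      (linearCombination-zero v))))

  span-cong : ∀ {k} {u v : Vector Carrierᴹ k} → (∀ i → u i ≈ᴹ v i) → span u ⊆ span v
  span-cong u≈v (s , eq) =
    s , ≈ᴹ-trans (linearCombination-cong (λ _ → R.refl) (λ i → ≈ᴹ-sym (u≈v i))) eq

  0⊆span : ∀ {k} (v : Vector Carrierᴹ k) → ｛0｝ ⊆ span v
  0⊆span v x≈0 = (λ _ → R.0#) , ≈ᴹ-trans (linearCombination-zero v) (≈ᴹ-sym x≈0)

  -- Closure under scalars puts `(- 1) *ₗ x` in `P`; it is an additive inverse of `x`, hence equal
  -- to `-ᴹ x`.
  subspace-neg : ∀ {P : Pred Carrierᴹ p} → IsSubspace P → ∀ {x} → x ∈ P → -ᴹ x ∈ P
  subspace-neg isSubspace {x} x∈P =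
    respects (inverseˡ-unique _ _ -1*x+x≈0) (*ₗ-closed (R.- R.1#) x∈P)
    where
    open IsSubspace isSubspace
    open AbelianGroupProperties +ᴹ-abelianGroup using (inverseˡ-unique)
    -1*x+x≈0 : (R.- R.1#) *ₗ x +ᴹ x ≈ᴹ 0ᴹ
    -1*x+x≈0 =
      ≈ᴹ-trans (+ᴹ-congˡ (≈ᴹ-sym (*ₗ-identityˡ x)))
      (≈ᴹ-trans (≈ᴹ-sym (*ₗ-distribʳ x (R.- R.1#) R.1#))
      (≈ᴹ-trans (*ₗ-congʳ (R.-‿inverseˡ R.1#)) (*ₗ-zeroˡ x)))

-- Supports and descendants.

module _ {q Q m : ℕ} {F : FiniteField q c₁ ℓ₁} {K : FiniteField Q c₂ ℓ₂}
         {K/F : Extension F K} (B : ExtensionBasis K/F m) where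
  private
    module F = FiniteField F
    module K = FiniteField K
  open ExtensionBasis B

  -- `spanning` merely picks some coefficients for each representative; independence of the basis
  -- makes them unique, hence compatible with `≈`.
  coordinates-cong : ∀ {x y} → x K.≈ y → ∀ i → coordinates x i F.≈ coordinates y i
  coordinates-cong {x} {y} x≈y =
    independent⇒coefficients-unique (Extension.leftModule K/F) independent
      (coordinates x) (coordinates y)
      (K.trans (proj₂ (spanning {x} _)) (K.trans x≈y (K.sym (proj₂ (spanning {y} _)))))

  module _ (n : ℕ) where
    open RankMetric B n
    private
      module Fⁿ = Linear (vectorModule F.ring n)
      module Kⁿ where
        open LeftModule (vectorModule K.ring n) public
        open Linear (vectorModule K.ring n) public
        open AbelianGroupProperties +ᴹ-abelianGroup public
          using (⁻¹-involutive; ε⁻¹≈ε; x∙y⁻¹≈ε⇒x≈y)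

    _−_ : Word → Word → Word
    x − y = x Kⁿ.+ᴹ (Kⁿ.-ᴹ y)

    σ-cong : ∀ {x y} → x Kⁿ.≈ᴹ y → σ x ⊆ σ y
    σ-cong x≈y =
      span-cong (vectorModule F.ring n) λ i j → coordinates-cong (x≈y j) i

    σ-minus-congʳ : ∀ w {x y} → x Kⁿ.≈ᴹ y → σ (w − x) ⊆ σ (w − y)
    σ-minus-congʳ w x≈y = σ-cong (Kⁿ.+ᴹ-congˡ {w} (Kⁿ.-ᴹ‿cong x≈y))

    0⊆σ : ∀ x → Fⁿ.｛0｝ ⊆ σ x
    0⊆σ x = 0⊆span (vectorModule F.ring n) (Mat x)

    0−-x≈x : ∀ x → (Kⁿ.0ᴹ − (Kⁿ.-ᴹ x)) Kⁿ.≈ᴹ x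
    0−-x≈x x = Kⁿ.≈ᴹ-trans (Kⁿ.+ᴹ-identityˡ _) (Kⁿ.⁻¹-involutive x)

    0≈-x⇒x≈0 : ∀ {x} → Kⁿ.0ᴹ Kⁿ.≈ᴹ (Kⁿ.-ᴹ x) → x Kⁿ.≈ᴹ Kⁿ.0ᴹ
    0≈-x⇒x≈0 {x} 0≈-x =
      Kⁿ.≈ᴹ-trans (Kⁿ.≈ᴹ-sym (Kⁿ.⁻¹-involutive x))
      (Kⁿ.≈ᴹ-trans (Kⁿ.-ᴹ‿cong (Kⁿ.≈ᴹ-sym 0≈-x)) Kⁿ.ε⁻¹≈ε)

    -- Membership up to `≈ᴹ` makes this a subset in the sense of `IsFrameproof`, at the level `ℓ₂`
    -- required there.
    pair : Word → Word → Pred Word ℓ₂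
    pair x y z = z Kⁿ.≈ᴹ x ⊎ z Kⁿ.≈ᴹ y

    pair-respects : ∀ x y → pair x y Respects Kⁿ._≈ᴹ_
    pair-respects x y z≈z′ (inj₁ z≈x) = inj₁ (Kⁿ.≈ᴹ-trans (Kⁿ.≈ᴹ-sym z≈z′) z≈x)
    pair-respects x y z≈z′ (inj₂ z≈y) = inj₂ (Kⁿ.≈ᴹ-trans (Kⁿ.≈ᴹ-sym z≈z′) z≈y)

    pair-cardinality : ∀ x y → CardinalityAtMost (pair x y) 2
    pair-cardinality x y =
      covered⇒cardinality≤2 (On.setoid Kⁿ.≈ᴹ-setoid proj₁)
        {x , inj₁ Kⁿ.≈ᴹ-refl} {y , inj₂ Kⁿ.≈ᴹ-refl}
        -- Equality in the finite field `K` is decidable, hence so is equality of words.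
        (decidable (finite⇒decidable K.setoid K.cardinality) x y) proj₂

    -- Since 0 - (-x) = x, the supports being intersected are `σ x` and `σ y`.
    0∈desc-pair : ∀ x y → σ x ∩ σ y ≐ Fⁿ.｛0｝ →
                  Kⁿ.0ᴹ ∈ desc (pair (Kⁿ.-ᴹ x) (Kⁿ.-ᴹ y))
    0∈desc-pair x y (meet⊆0 , _) =
        (λ v∈⋂ → meet⊆0 ( σ-cong (0−-x≈x x) (v∈⋂ (Kⁿ.-ᴹ x , inj₁ Kⁿ.≈ᴹ-refl))
                         , σ-cong (0−-x≈x y) (v∈⋂ (Kⁿ.-ᴹ y , inj₂ Kⁿ.≈ᴹ-refl))))
      , (λ v≈0 (z , _) → 0⊆σ (Kⁿ.0ᴹ − z) v≈0)

    -- Each `σ (w − z)` with `z` in `S` is one of the two supports, so their meet lies in the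
    -- intersection over `S`, which is zero.
    desc-covered : ∀ {S : Pred Word p} {w} → w ∈ desc S → ∀ {x y} →
                   (∀ z → z ∈ S → z Kⁿ.≈ᴹ x ⊎ z Kⁿ.≈ᴹ y) →
                   σ (w − x) ∩ σ (w − y) ≐ Fⁿ.｛0｝
    desc-covered {w = w} (⋂⊆0 , _) {x} {y} covers =
        (λ (v∈σx , v∈σy) → ⋂⊆0 λ (z , z∈S) →
           [ (λ z≈x → σ-minus-congʳ w (Kⁿ.≈ᴹ-sym z≈x) v∈σx)
           , (λ z≈y → σ-minus-congʳ w (Kⁿ.≈ᴹ-sym z≈y) v∈σy)
           ]′ (covers z z∈S))
      , (λ v≈0 → 0⊆σ (w − x) v≈0 , 0⊆σ (w − y) v≈0)

    -- An empty intersection contains the all-ones vector, whose first coordinate exists and is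
    -- nonzero.
    desc-empty : 1 ≤ n → ∀ {S : Pred Word p} → ¬ ∃ S → ∀ w → w ∉ desc S
    desc-empty (s≤s _) S-empty w (⋂⊆0 , _) =
      F.0≉1 (F.sym (⋂⊆0 {λ _ → F.1#} (λ s → contradiction s S-empty) zero))

    -- The two implications for a linear code.

    module _ {C : Pred Word p} (isSubspace : Kⁿ.IsSubspace C) where
      open Kⁿ.IsSubspace isSubspace

      neg-closed : ∀ {x} → x ∈ C → (Kⁿ.-ᴹ x) ∈ C
      neg-closed = subspace-neg (vectorModule K.ring n) isSubspace

      frameproof⇒intersecting : IsFrameproof 2 C → IsIntersecting C
      frameproof⇒intersecting frameproof x y (x∈C , x≉0) (y∈C , y≉0) meet≐0 =
        frameproof (pair -x -y) (pair-respects -x -y) pair⊆C (pair-cardinality -x -y) Kⁿ.0ᴹ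
          ( 0∈desc-pair x y meet≐0
          -- The zero word is a codeword outside the pair: being equal to -x or -y would make `x` or
          -- `y` zero.
          , 0ᴹ-closed
          , [ (λ 0≈-x → x≉0 (0≈-x⇒x≈0 0≈-x)) , (λ 0≈-y → y≉0 (0≈-x⇒x≈0 0≈-y)) ]′)
        where
        -x = Kⁿ.-ᴹ x
        -y = Kⁿ.-ᴹ y
        pair⊆C : pair -x -y ⊆ C
        pair⊆C (inj₁ z≈-x) = respects (Kⁿ.≈ᴹ-sym z≈-x) (neg-closed x∈C)
        pair⊆C (inj₂ z≈-y) = respects (Kⁿ.≈ᴹ-sym z≈-y) (neg-closed y∈C)

      intersecting⇒frameproof : 1 ≤ n → IsIntersecting C → IsFrameproof 2 C
      intersecting⇒frameproof 1≤n intersecting S S-respects S⊆C (t , t≤2 , card) w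
                              (w∈desc , w∈C , w∉S)
        with cardinality≤2⇒empty⊎covered (On.setoid Kⁿ.≈ᴹ-setoid proj₁) t≤2 card
      ... | inj₁ S-empty = desc-empty 1≤n S-empty w w∈desc
      ... | inj₂ ((x , x∈S) , (y , y∈S) , covers) =
        -- When `S` is a singleton, `x` and `y` coincide and the hypothesis is applied to the same
        -- word twice.
        intersecting (w − x) (w − y) (difference x∈S) (difference y∈S)
          (desc-covered w∈desc λ z z∈S → covers (z , z∈S))
        where
        difference : ∀ {z} → z ∈ S → (w − z) ∈ NonzeroIn C
        difference {z} z∈S =
            +ᴹ-closed w∈C (neg-closed (S⊆C z∈S))
          -- If w - z vanished, `w` would equal `z` and so belong to `S`.
          , λ w−z≈0 → w∉S (S-respects (Kⁿ.≈ᴹ-sym (Kⁿ.x∙y⁻¹≈ε⇒x≈y w z w−z≈0)) z∈S)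

theorem6p4 : ∀ {c₁ ℓ₁ c₂ ℓ₂ p : Level} (q m n k d : ℕ) →
    IsPrimePower q → 1 ≤ m → 1 ≤ n →
    (F : FiniteField q c₁ ℓ₁) (K : FiniteField (q ^ m) c₂ ℓ₂)
    (K/F : Extension F K) (B : ExtensionBasis K/F m) →
    let open RankMetric B n in
    (C : Pred Word p) → IsCode k d C →
    IsFrameproof 2 C ⇔ IsIntersecting C
theorem6p4 q m n k d _ _ 1≤n F K K/F B C isCode =
  mk⇔ (frameproof⇒intersecting B n isSubspace) (intersecting⇒frameproof B n isSubspace 1≤n)
  where open RankMetric.IsCode isCode using (isSubspace)
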